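{- Let $W\ge 1$ and $r\ge 1$ be integers, and run the guarded-epoch filter with parameters $W,r$ and epoch length $\ell=\lceil W/r\rceil$ on an arbitrary stream $x_0,x_1,x_2,\ldots$. Then at every insertion time $t\ge 0$ (immediately after insertion number $t$ is completed), every key inserted during the last $W$ insertions is represented in at least one segment; that is, for every index $i$ with $\max(0,t-W+1)\le i\le t$, the key $x_i$ is represented at time $t$ in at least one of the segments $B_0,\ldots,B_r$.
   Context: Stream: a sequence $x_0,x_1,x_2,\ldots$ of keys from a universe $U$. $W$ is the target window length; the live set at time $t$ is $L_t=\{x_i:\max(0,t-W+1)\le i\le t\}$. Guarded-epoch filter: it has $r+1$ bit arrays (segments) $B_0,\ldots,B_r$, each of $s\ge 1$ bits, all initially zero, and a current-segment index $c$, initially $c=0$. Under a total budget of $m$ bits, $s=\lfloor m/(r+1)\rfloor$. The epoch length is $\ell=\lceil W/r\rceil$. Each key $x\in U$ has, in each segment, $k\ge 1$ fixed bit positions determined by hash functions (its Bloom positions). Insertion number $t$ (for $t=0,1,2,\ldots$) proceeds as follows: if $t>0$ and $t \bmod \ell=0$, set $c\leftarrow (c+1)\bmod (r+1)$ and clear $B_c$ (set all its bits to $0$); then insert $x_t$ by setting its $k$ Bloom positions in $B_c$ to $1$. No other operation modifies the segments. A query for a key $y$ tests the $k$ positions of $y$ in every segment and returns true if some segment has all of them equal to $1$. A key $x$ is represented at time $t$ in segment $B_j$ if some insertion of $x$ with number $i\le t$ was written to $B_j$ and $B_j$ has not been cleared since that write, up to and including insertion number $t$. -}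

module Defs where

open import Data.Bool using (Bool; true; false; if_then_else_)
open import Data.Fin using (Fin; zero; toℕ)
open import Data.List using (List; []; _∷_; foldl)
open import Data.List.Membership.Propositional using (_∈_; _∉_)
open import Data.Nat
open import Data.Nat.DivMod
open import Data.Nat.Properties
open import Data.Product using (_×_; _,_; proj₁; proj₂; ∃-syntax)
open import Data.Vec using (Vec; replicate; _[_]≔_; _[_]%=_)
import Data.Vec as Vec
open import Function using (flip)
open import Function.Bundles using (_⇔_; mk⇔)
open import Relation.Binary.PropositionalEquality
open import Relation.Nullary using (Dec; does; _×-dec_)

⌈_/_⌉ : (m n : ℕ) .{{_ : NonZero n}} → ℕ
⌈ m / n ⌉ = (m + pred n) / n

-- ⌈ m / n ⌉ is the least natural number q with m / n ≤ q.
⌈/⌉-least : ∀ m n .{{_ : NonZero n}} q → ⌈ m / n ⌉ ≤ q ⇔ m ≤ q * n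
⌈/⌉-least m n@(suc n′) q = mk⇔ to from
  where
  open ≤-Reasoning

  to : ⌈ m / n ⌉ ≤ q → m ≤ q * n
  to h = +-cancelʳ-≤ n′ m (q * n) (begin
    m + n′                             ≡⟨ m≡m%n+[m/n]*n (m + n′) n ⟩
    (m + n′) % n + ⌈ m / n ⌉ * n       ≤⟨ +-mono-≤ (s≤s⁻¹ (m%n<n (m + n′) n)) (*-monoˡ-≤ n h) ⟩
    n′ + q * n                         ≡⟨ +-comm n′ (q * n) ⟩
    q * n + n′                         ∎)

  from : m ≤ q * n → ⌈ m / n ⌉ ≤ q
  from h = s≤s⁻¹ (m<n*o⇒m/o<n {m + n′} {suc q} {n} (begin-strict
    m + n′       ≤⟨ +-monoˡ-≤ n′ h ⟩
    q * n + n′   <⟨ +-monoʳ-< (q * n) (n<1+n n′) ⟩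
    q * n + n    ≡⟨ +-comm (q * n) n ⟩
    suc q * n    ∎))

⌈/⌉-nonZero : ∀ m n .{{_ : NonZero m}} .{{_ : NonZero n}} → NonZero ⌈ m / n ⌉
⌈/⌉-nonZero (suc m) n@(suc n′) =
  >-nonZero (m≥n⇒m/n>0 {suc m + n′} {n} (s≤s (m≤n+m n′ m)))

-- The hash functions enter only through the Bloom positions they determine:
-- `positions j x` lists the k positions of key x in segment j (repetitions
-- allowed).  The segment size s is a parameter; a budget m fixes it as
-- m / suc r.
module GuardedEpochFilter
  {a} {U : Set a} (W r s k : ℕ)
  .{{_ : NonZero W}} .{{_ : NonZero r}} .{{_ : NonZero s}} .{{_ : NonZero k}}
  (positions : Fin (suc r) → U → Vec (Fin s) k)
  where

  Segment : Set
  Segment = Fin (suc r)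

  BitArray : Set
  BitArray = Vec Bool s

  ℓ : ℕ
  ℓ = ⌈ W / r ⌉

  instance
    ℓ-nonZero : NonZero ℓ
    ℓ-nonZero = ⌈/⌉-nonZero W r

  data Op : Set a where
    clear : Segment → Op
    write : U → Segment → Op

  exec : Op → Vec BitArray (suc r) → Vec BitArray (suc r)
  exec (clear j)   B = B [ j ]≔ replicate s false
  exec (write x j) B =
    B [ j ]%= λ b → Vec.foldl (λ _ → BitArray) (λ b′ p → b′ [ p ]≔ true) b (positions j x)

  next : Segment → Segment
  next c = suc (toℕ c) mod suc r

  startsEpoch? : (t : ℕ) → Dec (0 < t × t % ℓ ≡ 0)
  startsEpoch? t = (0 <? t) ×-dec (t % ℓ ≟ 0)

  -- Insertion number t of key x when the current segment is c: the new current
  -- segment, and the operations on the segments in order of execution.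
  insertion : ℕ → U → Segment → Segment × List Op
  insertion t x c =
    if does (startsEpoch? t)
    then (next c , clear (next c) ∷ write x (next c) ∷ [])
    else (c , write x c ∷ [])

  record State : Set where
    field
      current  : Segment
      segments : Vec BitArray (suc r)

  open State public

  initial : State
  initial = record
    { current  = zero
    ; segments = replicate (suc r) (replicate s false)
    }

  step : ℕ → U → State → State
  step t x σ = record
    { current  = proj₁ (insertion t x (current σ))
    ; segments = foldl (flip exec) (segments σ) (proj₂ (insertion t x (current σ)))
    }

  -- The state just before insertion number t, i.e. after numbers 0, …, t - 1.
  before : (ℕ → U) → ℕ → State
  before xs zero    = initial
  before xs (suc t) = step t (xs t) (before xs t)

  ops : (ℕ → U) → ℕ → List Op
  ops xs t = proj₂ (insertion t (xs t) (current (before xs t)))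

  -- An insertion clears before it writes, so the clears that can follow the
  -- write of insertion i are those of insertions u > i.
  Represented : (ℕ → U) → U → ℕ → Segment → Set a
  Represented xs x t j =
    ∃[ i ] i ≤ t × write x j ∈ ops xs i × (∀ u → i < u → u ≤ t → clear j ∉ ops xs u)

{-# OPTIONS --safe #-}
module Submission where

-- Insertion t writes to segment (t / ℓ) mod (r + 1), and clears happen only at
-- multiples of ℓ.  If insertion u > i clears the segment written by insertion
-- i, the epochs of i and u are distinct but congruent modulo r + 1, so at least
-- r full epochs, hence r * ℓ ≥ W insertions, lie strictly between i and u.

open import Defs
open import Data.Bool using (if_then_else_)
open import Data.Fin using (Fin; toℕ)
open import Data.Fin.Properties using (toℕ-fromℕ<)
open import Data.List using ([]; _∷_)
open import Data.List.Membership.Propositional using (_∈_)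
open import Data.List.Relation.Unary.Any using (here; there)
open import Data.Nat using (ℕ; zero; suc; _+_; _*_; _∸_; _≤_; _<_; NonZero; z≤n; s≤s)
open import Data.Nat.DivMod
open import Data.Nat.Properties
open import Data.Product using (∃-syntax; _×_; _,_; proj₁; proj₂)
open import Data.Vec using (Vec)
open import Function using (_∘_; case_of_)
open import Function.Bundles using (Equivalence)
open import Relation.Binary.PropositionalEquality
open import Relation.Nullary using (¬_; yes; no)
open import Relation.Nullary.Decidable using (dec-true; dec-false)

m<[1+m/n]*n : ∀ m n .{{_ : NonZero n}} → m < suc (m / n) * n
m<[1+m/n]*n m n = begin-strict
  m                    ≡⟨ m≡m%n+[m/n]*n m n ⟩
  m % n + m / n * n    <⟨ +-monoˡ-< (m / n * n) (m%n<n m n) ⟩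
  suc (m / n) * n      ∎
  where open ≤-Reasoning

%≡0⇒≡[/]* : ∀ m n .{{_ : NonZero n}} → m % n ≡ 0 → m ≡ m / n * n
%≡0⇒≡[/]* m n eq = trans (m≡m%n+[m/n]*n m n) (cong (_+ m / n * n) eq)

*≤∧<*⇒/≡ : ∀ {m n q} .{{_ : NonZero n}} → q * n ≤ m → m < suc q * n → m / n ≡ q
*≤∧<*⇒/≡ {m} {n} {q} lo hi = ≤-antisym
  (m<1+n⇒m≤n (m<n*o⇒m/o<n {m} {suc q} {n} hi))
  (subst (_≤ m / n) (m*n/n≡m q n) (/-monoˡ-≤ n lo))

-- Since `suc m` is exactly `q * n`, `m` falls short of `q * n`, so the quotient must grow; one step
-- cannot raise it by more than one.
1+m%n≡0⇒1+m/n≡1+[m/n] : ∀ m n .{{_ : NonZero n}} → suc m % n ≡ 0 → suc m / n ≡ suc (m / n)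
1+m%n≡0⇒1+m/n≡1+[m/n] m n eq = *≤∧<*⇒/≡ lo hi
  where
  open ≤-Reasoning
  q = suc m / n
  m/n<q : m / n < q
  m/n<q = m<n*o⇒m/o<n {m} {q} {n} (≤-reflexive (%≡0⇒≡[/]* (suc m) n eq))
  lo : suc (m / n) * n ≤ suc m
  lo = ≤-trans (*-monoˡ-≤ n m/n<q) (m/n*n≤m (suc m) n)
  hi : suc m < suc (suc (m / n)) * n
  hi = begin-strict
    suc m                    ≤⟨ m<[1+m/n]*n m n ⟩
    suc (m / n) * n          <⟨ *-monoˡ-< n (n<1+n (suc (m / n))) ⟩
    suc (suc (m / n)) * n    ∎

-- The largest multiple of `n` up to `suc m` is not `suc m` itself, so it is already at most `m`.
1+m%n≢0⇒1+m/n≡m/n : ∀ m n .{{_ : NonZero n}} → suc m % n ≢ 0 → suc m / n ≡ m / n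
1+m%n≢0⇒1+m/n≡m/n m n ≢0 = sym (*≤∧<*⇒/≡ lo (<-trans (n<1+n m) (m<[1+m/n]*n (suc m) n)))
  where
  lo : suc m / n * n ≤ m
  lo = m<1+n⇒m≤n (≤∧≢⇒< (m/n*n≤m (suc m) n)
         (λ eq → ≢0 (trans (cong (_% n) (sym eq)) (m*n%n≡0 (suc m / n) n))))

[1+m%n]%n≡[1+m]%n : ∀ m n .{{_ : NonZero n}} → suc (m % n) % n ≡ suc m % n
[1+m%n]%n≡[1+m]%n m n = begin
  suc (m % n) % n                ≡⟨ [m+kn]%n≡m%n (suc (m % n)) (m / n) n ⟨
  suc (m % n + m / n * n) % n    ≡⟨ cong (λ x → suc x % n) (m≡m%n+[m/n]*n m n) ⟨
  suc m % n                      ∎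
  where open ≡-Reasoning

-- With equal remainders, `m < o` forces a strictly larger quotient, which adds at least one whole
-- `n`. To be applied to epoch numbers modulo `suc r`.
m<o∧m%n≡o%n⇒n+m≤o : ∀ {m o} n .{{_ : NonZero n}} → m < o → m % n ≡ o % n → n + m ≤ o
m<o∧m%n≡o%n⇒n+m≤o {m} {o} n m<o eq = begin
  n + m                        ≡⟨ cong (n +_) (m≡m%n+[m/n]*n m n) ⟩
  n + (m % n + m / n * n)      ≡⟨ +-assoc n (m % n) (m / n * n) ⟨
  n + m % n + m / n * n        ≡⟨ cong (_+ m / n * n) (+-comm n (m % n)) ⟩
  m % n + n + m / n * n        ≡⟨ +-assoc (m % n) n (m / n * n) ⟩
  m % n + suc (m / n) * n      ≤⟨ +-mono-≤ (≤-reflexive eq) (*-monoˡ-≤ n m/n<o/n) ⟩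
  o % n + o / n * n            ≡⟨ m≡m%n+[m/n]*n o n ⟨
  o                            ∎
  where
  open ≤-Reasoning
  m/n<o/n : m / n < o / n
  m/n<o/n = ≰⇒> λ o/n≤m/n → <⇒≱ m<o (begin
    o                    ≡⟨ m≡m%n+[m/n]*n o n ⟩
    o % n + o / n * n    ≤⟨ +-mono-≤ (≤-reflexive (sym eq)) (*-monoˡ-≤ n o/n≤m/n) ⟩
    m % n + m / n * n    ≡⟨ m≡m%n+[m/n]*n m n ⟨
    m                    ∎)

module _
  {a} {U : Set a} (W r s k : ℕ)
  .{{_ : NonZero W}} .{{_ : NonZero r}} .{{_ : NonZero s}} .{{_ : NonZero k}}
  (positions : Fin (suc r) → U → Vec (Fin s) k) (xs : ℕ → U)
  where

  open GuardedEpochFilter W r s k positions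

  insertion-starts : ∀ {t x c} → 0 < t × t % ℓ ≡ 0 →
    insertion t x c ≡ (next c , clear (next c) ∷ write x (next c) ∷ [])
  insertion-starts {t} starts = cong (λ b → if b then _ else _) (dec-true (startsEpoch? t) starts)

  insertion-continues : ∀ {t x c} → ¬ (0 < t × t % ℓ ≡ 0) →
    insertion t x c ≡ (c , write x c ∷ [])
  insertion-continues {t} ¬starts = cong (λ b → if b then _ else _) (dec-false (startsEpoch? t) ¬starts)

  -- The index is `suc t` because insertion `t` may advance the current segment before it writes.
  segmentAt : ℕ → Segment
  segmentAt t = current (before xs (suc t))

  -- Induction on `t`: the quotient by `ℓ` grows by one exactly when `next` is applied.
  toℕ-segmentAt : ∀ t → toℕ (segmentAt t) ≡ t / ℓ % suc r
  toℕ-segmentAt zero = sym (cong (_% suc r) (0/n≡0 ℓ))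
  toℕ-segmentAt (suc t) = case startsEpoch? (suc t) of λ where
      (yes starts@(_ , ≡0)) → begin
        toℕ (segmentAt (suc t))           ≡⟨
          cong (toℕ ∘ proj₁) (insertion-starts {suc t} {xs (suc t)} starts) ⟩
        toℕ (next (segmentAt t))          ≡⟨ toℕ-fromℕ< _ ⟩
        suc (toℕ (segmentAt t)) % suc r   ≡⟨ cong (λ q → suc q % suc r) (toℕ-segmentAt t) ⟩
        suc (t / ℓ % suc r) % suc r       ≡⟨ [1+m%n]%n≡[1+m]%n (t / ℓ) (suc r) ⟩
        suc (t / ℓ) % suc r               ≡⟨ cong (_% suc r) (1+m%n≡0⇒1+m/n≡1+[m/n] t ℓ ≡0) ⟨
        suc t / ℓ % suc r                 ∎
      (no ¬starts) → begin
        toℕ (segmentAt (suc t))           ≡⟨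
          cong (toℕ ∘ proj₁) (insertion-continues {suc t} {xs (suc t)} ¬starts) ⟩
        toℕ (segmentAt t)                 ≡⟨ toℕ-segmentAt t ⟩
        t / ℓ % suc r                     ≡⟨
          -- The guard `0 < suc t` always holds, so only the divisibility can have failed.
          cong (_% suc r) (1+m%n≢0⇒1+m/n≡m/n t ℓ (λ ≡0 → ¬starts (s≤s z≤n , ≡0))) ⟨
        suc t / ℓ % suc r                 ∎
    where open ≡-Reasoning

  write∈insertion : ∀ t x c → write x (proj₁ (insertion t x c)) ∈ proj₂ (insertion t x c)
  write∈insertion t x c
    with insertion t x c | insertion-starts {t} {x} {c}
       | insertion-continues {t} {x} {c} | startsEpoch? t
  ... | _ | eq | _ | yes starts with refl ← eq starts = there (here refl)
  ... | _ | _ | eq | no ¬starts with refl ← eq ¬starts = here refl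

  -- Only the branch that starts an epoch contains a clear, and its target is the segment just
  -- advanced to.
  clear∈insertion⇒ : ∀ {j} t x c → clear j ∈ proj₂ (insertion t x c) →
    t % ℓ ≡ 0 × j ≡ proj₁ (insertion t x c)
  clear∈insertion⇒ t x c j∈
    with insertion t x c | insertion-starts {t} {x} {c}
       | insertion-continues {t} {x} {c} | startsEpoch? t
  ... | _ | eq | _ | yes starts@(_ , ≡0) with refl ← eq starts | j∈
  ...   | here refl = ≡0 , refl
  ...   | there (here ())
  ...   | there (there ())
  clear∈insertion⇒ t x c j∈ | _ | _ | eq | no ¬starts with refl ← eq ¬starts | j∈
  ...   | here ()
  ...   | there ()

  write∈ops : ∀ t → write (xs t) (segmentAt t) ∈ ops xs t
  write∈ops t = write∈insertion t (xs t) (current (before xs t))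

  clear∈ops⇒ : ∀ {j} t → clear j ∈ ops xs t → t % ℓ ≡ 0 × j ≡ segmentAt t
  clear∈ops⇒ t = clear∈insertion⇒ t (xs t) (current (before xs t))

  -- The defining property of the ceiling, at `q = ℓ`.
  W≤r*ℓ : W ≤ r * ℓ
  W≤r*ℓ = subst (W ≤_) (*-comm ℓ r) (Equivalence.to (⌈/⌉-least W r ℓ) ≤-refl)

  W+i<clear : ∀ {i u} → i < u → clear (segmentAt i) ∈ ops xs u → W + i < u
  W+i<clear {i} {u} i<u j∈ = begin-strict
    -- Strictness comes from `i` lying before the end of its own epoch.
    W + i                       <⟨ +-mono-≤-< W≤r*ℓ (m<[1+m/n]*n i ℓ) ⟩
    r * ℓ + suc (i / ℓ) * ℓ     ≡⟨ *-distribʳ-+ ℓ r (suc (i / ℓ)) ⟨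
    (r + suc (i / ℓ)) * ℓ       ≡⟨ cong (_* ℓ) (+-suc r (i / ℓ)) ⟩
    (suc r + i / ℓ) * ℓ         ≤⟨ *-monoˡ-≤ ℓ (m<o∧m%n≡o%n⇒n+m≤o (suc r) i/ℓ<u/ℓ same) ⟩
    u / ℓ * ℓ                   ≡⟨ u≡ ⟨
    u                           ∎
    where
    open ≤-Reasoning
    u≡ : u ≡ u / ℓ * ℓ
    u≡ = %≡0⇒≡[/]* u ℓ (proj₁ (clear∈ops⇒ u j∈))
    i/ℓ<u/ℓ : i / ℓ < u / ℓ
    -- As the clear happens at the very start of epoch `u / ℓ`, any earlier `i` belongs to an
    -- earlier epoch.
    i/ℓ<u/ℓ = m<n*o⇒m/o<n {i} {u / ℓ} {ℓ} (subst (i <_) u≡ i<u)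
    same : i / ℓ % suc r ≡ u / ℓ % suc r
    same = trans (sym (toℕ-segmentAt i))
                 (trans (cong toℕ (proj₂ (clear∈ops⇒ u j∈))) (toℕ-segmentAt u))

lemma1 : ∀ {a} {U : Set a} (W r s k : ℕ)
    .{{_ : NonZero W}} .{{_ : NonZero r}} .{{_ : NonZero s}} .{{_ : NonZero k}}
    (positions : Fin (suc r) → U → Vec (Fin s) k) (xs : ℕ → U) (t i : ℕ) →
    suc t ∸ W ≤ i → i ≤ t →
    ∃[ j ] GuardedEpochFilter.Represented W r s k positions xs (xs i) t j
lemma1 W r s k positions xs t i live i≤t =
  -- The witness is the segment that insertion `i` itself wrote to.
  segmentAt W r s k positions xs i , i , i≤t , write∈ops W r s k positions xs i ,
  λ u i<u u≤t j∈ → <⇒≱ (W+i<clear W r s k positions xs i<u j∈) (begin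
    u                  ≤⟨ u≤t ⟩
    t                  ≤⟨ n≤1+n t ⟩
    -- Truncated subtraction plays the part of the maximum with 0; the bound holds also when
    -- `suc t < W`.
    suc t              ≤⟨ m≤n+m∸n (suc t) W ⟩
    W + (suc t ∸ W)    ≤⟨ +-monoʳ-≤ W live ⟩
    W + i              ∎)
  where open ≤-Reasoning
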